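{- For all integers $n\ge 2$ and $1\le k<n$, the independence number of $G=H_B(n,k)$ is $\alpha(G)=\sum_{i=1}^n 2^{i-1}\binom{n}{i}-\binom{n}{k}$ (and $V_2$ is a maximum independent set).
   Context: Fix integers $n\ge 2$ and $1\le k<n$ and positive real numbers $x_1<x_2<\dots<x_n$. Let $\mathscr{B}_n=\{\pm x_1,\pm x_2,\dots,\pm x_{n-1},x_n\}$ (so $-x_n\notin\mathscr{B}_n$). Let $\phi(\mathscr{B}_n)$ be the family of all nonempty subsets $S\subseteq\mathscr{B}_n$ whose elements have pairwise distinct absolute values and whose element of largest absolute value is positive. Let $\mathscr{B}_n^+=\{x_1,\dots,x_n\}$, let $V_1$ be the set of all $k$-element subsets of $\mathscr{B}_n^+$, and let $V_2=\phi(\mathscr{B}_n)\setminus V_1$. For $A\in\phi(\mathscr{B}_n)$ put $A^\dagger=\{|a|:a\in A\}$. The bipartite Kneser B type-$k$ graph $H_B(n,k)$ is the simple graph with vertex set $V_1\cup V_2$ in which $X\in V_1$ and $Y\in V_2$ are adjacent if and only if $X\subseteq Y^\dagger$ or $Y^\dagger\subseteq X$, and there are no other edges. The independence number is the maximum size of a set of pairwise nonadjacent vertices. -}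

module Defs where

open import Data.Empty using (⊥)
open import Data.Fin.Base using (Fin; inject≤)
open import Data.Fin.Subset using (Subset; ∣_∣) renaming (_∈_ to _∈ˢ_)
open import Data.List.Base using (List; length; map; sum; applyUpTo)
open import Data.List.Membership.Propositional using (_∈_)
open import Data.List.Relation.Unary.Unique.Propositional using (Unique)
open import Data.Nat.Base as ℕ using (ℕ; suc; pred)
open import Data.Nat.Properties using (pred[n]≤n)
open import Data.Product.Base using (Σ-syntax; ∃-syntax; _×_; _,_; proj₂)
open import Data.Rational.Base as ℚ using (ℚ; 0ℚ; 1ℚ)
import Data.Rational.Properties as ℚ
import Algebra.Properties.Group as GroupProperties
open import Data.Sum.Base using (_⊎_; inj₁; inj₂; swap)
open import Data.Vec.Functional using (_++_)
open import Level using (Level; 0ℓ; _⊔_) renaming (suc to lsuc)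
open import Relation.Binary.Core using (Rel)
open import Relation.Binary.Definitions using (Symmetric; tri<; tri≈; tri>)
open import Relation.Binary.PropositionalEquality.Core using (_≡_; refl; sym; subst)
open import Relation.Nullary.Negation.Core using (¬_)
open import Relation.Unary using (Pred; Satisfiable; _⊆_; _≐_; _∪_; _∖_)

private variable
  a ℓ : Level

-- The standard library has no real numbers; these are the (two-sided)
-- Dedekind reals: L is the set of rationals strictly below the number and U
-- the set of rationals strictly above it.
record ℝ : Set₁ where
  field
    L U         : Pred ℚ 0ℓ
    L-inhabited : ∃[ q ] L q
    U-inhabited : ∃[ q ] U q
    L-lower     : ∀ {p q} → p ℚ.< q → L q → L p
    U-upper     : ∀ {p q} → p ℚ.< q → U p → U q
    L-open      : ∀ {p} → L p → ∃[ q ] (p ℚ.< q × L q)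
    U-open      : ∀ {q} → U q → ∃[ p ] (p ℚ.< q × U p)
    disjoint    : ∀ {q} → L q → U q → ⊥
    located     : ∀ {p q} → p ℚ.< q → L p ⊎ U q

open ℝ

infix 4 _≈ℝ_ _<ℝ_ _≤ℝ_

-- The upper cut is determined by the lower one, so comparing lower cuts suffices.
_≈ℝ_ : Rel ℝ 0ℓ
x ≈ℝ y = L x ≐ L y

_≤ℝ_ : Rel ℝ 0ℓ
x ≤ℝ y = L x ⊆ L y

_<ℝ_ : Rel ℝ 0ℓ
x <ℝ y = ∃[ q ] (U x q × L y q)

private
  neg-neg : ∀ q → ℚ.- (ℚ.- q) ≡ q
  neg-neg = GroupProperties.⁻¹-involutive ℚ.+-0-group

  neg-<ˡ : ∀ {p q} → ℚ.- p ℚ.< q → ℚ.- q ℚ.< p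
  neg-<ˡ {p} {q} lt = subst (ℚ.- q ℚ.<_) (neg-neg p) (ℚ.neg-antimono-< lt)

  neg-<ʳ : ∀ {p q} → p ℚ.< ℚ.- q → q ℚ.< ℚ.- p
  neg-<ʳ {p} {q} lt = subst (ℚ._< ℚ.- p) (neg-neg q) (ℚ.neg-antimono-< lt)

  p<p+1 : ∀ p → p ℚ.< p ℚ.+ 1ℚ
  p<p+1 p = subst (ℚ._< p ℚ.+ 1ℚ) (ℚ.+-identityʳ p)
    (ℚ.+-monoʳ-< p (ℚ.positive⁻¹ 1ℚ))

  p-1<p : ∀ p → p ℚ.- 1ℚ ℚ.< p
  p-1<p p = subst (p ℚ.- 1ℚ ℚ.<_) (ℚ.+-identityʳ p)
    (ℚ.+-monoʳ-< p (ℚ.negative⁻¹ (ℚ.- 1ℚ)))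

fromℚ : ℚ → ℝ
fromℚ r = record
  { L           = ℚ._< r
  ; U           = r ℚ.<_
  ; L-inhabited = r ℚ.- 1ℚ , p-1<p r
  ; U-inhabited = r ℚ.+ 1ℚ , p<p+1 r
  ; L-lower     = ℚ.<-trans
  ; U-upper     = λ p<q r<p → ℚ.<-trans r<p p<q
  ; L-open      = λ p<r → let q , p<q , q<r = ℚ.<-dense p<r in q , p<q , q<r
  ; U-open      = λ r<q → let p , r<p , p<q = ℚ.<-dense r<q in p , p<q , r<p
  ; disjoint    = ℚ.<-asym
  ; located     = loc
  }
  where
  loc : ∀ {p q} → p ℚ.< q → p ℚ.< r ⊎ r ℚ.< q
  loc {p} p<q with ℚ.<-cmp p r
  ... | tri< p<r _ _    = inj₁ p<r
  ... | tri≈ _ refl _   = inj₂ p<q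
  ... | tri> _ _ r<p    = inj₂ (ℚ.<-trans r<p p<q)

0ℝ : ℝ
0ℝ = fromℚ 0ℚ

-ℝ_ : ℝ → ℝ
-ℝ x = record
  { L           = λ q → U x (ℚ.- q)
  ; U           = λ q → L x (ℚ.- q)
  ; L-inhabited = let q , u = U-inhabited x in ℚ.- q , subst (U x) (sym (neg-neg q)) u
  ; U-inhabited = let q , l = L-inhabited x in ℚ.- q , subst (L x) (sym (neg-neg q)) l
  ; L-lower     = λ p<q → U-upper x (ℚ.neg-antimono-< p<q)
  ; U-upper     = λ p<q → L-lower x (ℚ.neg-antimono-< p<q)
  ; L-open      = λ u → let r , r<-p , ur = U-open x u in
                    ℚ.- r , neg-<ʳ r<-p , subst (U x) (sym (neg-neg r)) ur
  ; U-open      = λ l → let r , -q<r , lr = L-open x l in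
                    ℚ.- r , neg-<ˡ -q<r , subst (L x) (sym (neg-neg r)) lr
  ; disjoint    = λ u l → disjoint x l u
  ; located     = λ p<q → swap (located x (ℚ.neg-antimono-< p<q))
  }

-- ∣ x ∣ℝ is the maximum of x and - x: a rational lies below the maximum iff it
-- lies below one of the two, and above it iff it lies above both.
∣_∣ℝ : ℝ → ℝ
∣ x ∣ℝ = record
  { L           = λ q → L x q ⊎ L (-ℝ x) q
  ; U           = λ q → U x q × U (-ℝ x) q
  ; L-inhabited = let q , l = L-inhabited x in q , inj₁ l
  ; U-inhabited = U-inh
  ; L-lower     = λ { p<q (inj₁ l) → inj₁ (L-lower x p<q l)
                    ; p<q (inj₂ l) → inj₂ (L-lower (-ℝ x) p<q l) }
  ; U-upper     = λ p<q (u , v) → U-upper x p<q u , U-upper (-ℝ x) p<q v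
  ; L-open      = λ { (inj₁ l) → let r , p<r , lr = L-open x l in r , p<r , inj₁ lr
                    ; (inj₂ l) → let r , p<r , lr = L-open (-ℝ x) l in r , p<r , inj₂ lr }
  ; U-open      = U-op
  ; disjoint    = λ { (inj₁ l) (u , _) → disjoint x l u
                    ; (inj₂ l) (_ , v) → disjoint (-ℝ x) l v }
  ; located     = loc
  }
  where
  U-inh : ∃[ q ] (U x q × U (-ℝ x) q)
  U-inh with U-inhabited x | U-inhabited (-ℝ x)
  ... | p , u | q , v with ℚ.<-cmp p q
  ...   | tri< p<q _ _  = q , U-upper x p<q u , v
  ...   | tri≈ _ refl _ = q , u , v
  ...   | tri> _ _ q<p  = p , u , U-upper (-ℝ x) q<p v

  U-op : ∀ {q} → U x q × U (-ℝ x) q → ∃[ p ] (p ℚ.< q × (U x p × U (-ℝ x) p))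
  U-op (u , v) with U-open x u | U-open (-ℝ x) v
  ... | p , p<q , up | r , r<q , vr with ℚ.<-cmp p r
  ...   | tri< p<r _ _  = r , r<q , U-upper x p<r up , vr
  ...   | tri≈ _ refl _ = r , r<q , up , vr
  ...   | tri> _ _ r<p  = p , p<q , up , U-upper (-ℝ x) r<p vr

  loc : ∀ {p q} → p ℚ.< q → (L x p ⊎ L (-ℝ x) p) ⊎ (U x q × U (-ℝ x) q)
  loc p<q with located x p<q | located (-ℝ x) p<q
  ... | inj₁ l | _      = inj₁ (inj₁ l)
  ... | inj₂ _ | inj₁ l = inj₁ (inj₂ l)
  ... | inj₂ u | inj₂ v = inj₂ (u , v)

record SimpleGraph (A : Set a) (ℓ : Level) : Set (a ⊔ lsuc ℓ) where
  field
    Vertex     : Pred A ℓ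
    Adj        : Rel A ℓ
    adj-vertex : ∀ {u v} → Adj u v → Vertex u × Vertex v
    adj-sym    : Symmetric Adj
    adj-irrefl : ∀ {v} → ¬ Adj v v

HasSize : {A : Set a} → Pred A ℓ → ℕ → Set (a ⊔ ℓ)
HasSize {A = A} P m =
  Σ[ xs ∈ List A ] (Unique xs × (P ≐ (_∈ xs)) × length xs ≡ m)

module _ {A : Set a} (G : SimpleGraph A ℓ) where
  open SimpleGraph G

  IsIndependent : Pred A ℓ → Set (a ⊔ ℓ)
  IsIndependent P = P ⊆ Vertex × (∀ {u v} → P u → P v → ¬ Adj u v)

  BoundsIndependentSets : ℕ → Set (a ⊔ lsuc ℓ)
  BoundsIndependentSets m =
    ∀ (Q : Pred A ℓ) s → IsIndependent Q → HasSize Q s → s ℕ.≤ m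

  IsIndependenceNumber : ℕ → Set (a ⊔ lsuc ℓ)
  IsIndependenceNumber α =
    (∃[ P ] (IsIndependent P × HasSize P α)) × BoundsIndependentSets α

  IsMaximumIndependentSet : Pred A ℓ → Set (a ⊔ lsuc ℓ)
  IsMaximumIndependentSet P =
    IsIndependent P × (∃[ m ] (HasSize P m × BoundsIndependentSets m))

module KneserB (n k : ℕ) (x : Fin n → ℝ) where

  -- The elements x₁, …, xₙ, - x₁, …, - xₙ₋₁ of 𝓑ₙ; they are pairwise distinct
  -- whenever 0 < x₁ < … < xₙ.
  𝓑 : Fin (n ℕ.+ pred n) → ℝ
  𝓑 = x ++ (λ j → -ℝ x (inject≤ j pred[n]≤n))

  𝓑⁺ : Pred ℝ 0ℓ
  𝓑⁺ r = ∃[ i ] (r ≈ℝ x i)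

  -- Sets of reals have no decidable equality, so a subset of 𝓑ₙ is given by the
  -- set S of its indices in the enumeration 𝓑; ⟦ S ⟧ is the set of reals itself.
  -- As 𝓑 is injective, S and ⟦ S ⟧ determine each other and ∣ S ∣ is the
  -- cardinality of ⟦ S ⟧.
  SubsetOf𝓑 : Set
  SubsetOf𝓑 = Subset (n ℕ.+ pred n)

  ⟦_⟧ : SubsetOf𝓑 → Pred ℝ 0ℓ
  ⟦ S ⟧ r = ∃[ i ] (i ∈ˢ S × r ≈ℝ 𝓑 i)

  infix 10 _†
  _† : Pred ℝ 0ℓ → Pred ℝ (lsuc 0ℓ)
  (A †) r = ∃[ a ] (A a × r ≈ℝ ∣ a ∣ℝ)

  φ : Pred SubsetOf𝓑 (lsuc 0ℓ)
  φ S = Satisfiable ⟦ S ⟧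
      × (∀ {a b} → ⟦ S ⟧ a → ⟦ S ⟧ b → ∣ a ∣ℝ ≈ℝ ∣ b ∣ℝ → a ≈ℝ b)
      × (∃[ a ] (⟦ S ⟧ a × (∀ {b} → ⟦ S ⟧ b → ∣ b ∣ℝ ≤ℝ ∣ a ∣ℝ) × 0ℝ <ℝ a))

  V₁ : Pred SubsetOf𝓑 (lsuc 0ℓ)
  V₁ S = ⟦ S ⟧ ⊆ 𝓑⁺ × ∣ S ∣ ≡ k

  V₂ : Pred SubsetOf𝓑 (lsuc 0ℓ)
  V₂ = φ ∖ V₁

  Joined : Rel SubsetOf𝓑 (lsuc 0ℓ)
  Joined X Y = V₁ X × V₂ Y × (⟦ X ⟧ ⊆ ⟦ Y ⟧ † ⊎ ⟦ Y ⟧ † ⊆ ⟦ X ⟧)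

  H_B : SimpleGraph SubsetOf𝓑 (lsuc 0ℓ)
  H_B = record
    { Vertex     = V₁ ∪ V₂
    ; Adj        = λ X Y → Joined X Y ⊎ Joined Y X
    ; adj-vertex = λ { (inj₁ (p , q , _)) → inj₁ p , inj₂ q
                     ; (inj₂ (p , q , _)) → inj₂ q , inj₁ p }
    ; adj-sym    = swap
    ; adj-irrefl = λ { (inj₁ (p , q , _)) → proj₂ q p
                     ; (inj₂ (p , q , _)) → proj₂ q p }
    }

-- Σ_{i=1}^n f i
∑₁ : ℕ → (ℕ → ℕ) → ℕ
∑₁ n f = sum (map f (applyUpTo suc n))

{-# OPTIONS --safe #-}
module Submission where

-- V₂ is independent because every edge meets V₁. Conversely, sending X ∈ V₁ to
-- Y = {xₙ} ∪ - (X ∖ {xₙ}), with x₁ added when x₁ ∉ X, is a matching of V₁ into V₂: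
-- X ⊆ Y †, and X is recovered from the negative part of Y and ∣ X ∣ = k. Hence no
-- independent set is larger than V₂. The size t n of φ satisfies t (n + 1) = 3 t n + 1,
-- as the smallest element can be absent, positive or negative over each set in φ for
-- the others, or form a set on its own; by Pascal's rule so does the stated sum.

open import Defs
open import Data.Bool.Base using (not)
open import Data.Bool.Properties using () renaming (_≟_ to _≟ᵇ_)
open import Data.Empty using (⊥-elim)
open import Data.Fin.Base as Fin using (Fin; zero; suc; fromℕ; inject₁; splitAt; _↑ˡ_; _↑ʳ_)
import Data.Fin.Properties as Fin
open import Data.Fin.Relation.Unary.Top using (view; ‵fromℕ; ‵inject₁)
open import Data.Fin.Subset as Subset using (Subset; inside; outside; ∣_∣; ⁅_⁆) renaming (_∈_ to _∈ˢ_; _∉_ to _∉ˢ_)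
import Data.Fin.Subset.Properties as Subset
open import Data.Integer.Base as ℤ using (+_)
import Data.Integer.Properties as ℤ
open import Data.List.Base using (List; []; _∷_; [_]; length; map; applyUpTo; filter; _++_)
open import Data.List.Membership.Propositional using (_∈_)
open import Data.List.Membership.Propositional.Properties
  using (∈-∃++; ∈-map⁺; ∈-map⁻; ∈-++⁺ˡ; ∈-++⁺ʳ; ∈-++⁻; ∈-filter⁺; ∈-filter⁻)
import Data.List.Membership.DecPropositional as DecMembership
open import Data.List.Properties using (length-map; length-++; map-++; applyUpTo-∷ʳ)
open import Data.List.Relation.Binary.Disjoint.Propositional using (Disjoint)
import Data.List.Relation.Unary.All as All
open import Data.List.Relation.Unary.AllPairs using ([]; _∷_)
open import Data.List.Relation.Unary.Any using (here; there)
open import Data.List.Relation.Unary.Unique.Propositional using (Unique)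
import Data.List.Relation.Unary.Unique.Propositional.Properties as Unique
open import Data.Nat.Base using (ℕ; zero; suc; _+_; _*_; _^_; _∸_; _≤_; _<_; z≤n; s≤s; s≤s⁻¹)
open import Data.Nat.Combinatorics using (_C_; nCk+nC[k+1]≡[n+1]C[k+1]; k>n⇒nCk≡0)
open import Data.Nat.ListAction using (sum)
open import Data.Nat.ListAction.Properties using (sum-++)
import Data.Nat.Properties as ℕ
open import Data.Nat.Tactic.RingSolver using (solve-∀)
open import Data.Product.Base using (∃-syntax; _×_; _,_; proj₁; proj₂; uncurry)
open import Data.Rational.Base as ℚ using ()
import Data.Rational.Properties as ℚ
import Algebra.Properties.Group as GroupProperties
open import Data.Sum.Base using (_⊎_; inj₁; inj₂; [_,_]′)
open import Data.Vec.Base as Vec using ([]; _∷_; init) renaming (_++_ to _++ᵛ_)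
import Data.Vec.Functional.Properties as Vector
import Data.Vec.Properties as Vec
open import Function.Base using (_∘_; id)
open import Level using (Level)
open import Relation.Binary.Core using (REL)
open import Relation.Binary.Definitions using (DecidableEquality; tri<; tri≈; tri>)
open import Relation.Binary.PropositionalEquality
  using (_≡_; refl; sym; trans; cong; cong₂; subst; module ≡-Reasoning)
open import Relation.Nullary.Negation using (¬_; contradiction)
open import Relation.Nullary.Decidable using (yes; no; ¬?)
open import Relation.Unary using (Pred; _⊆_; _∖_; _∪_)

private variable
  a b ℓ ℓ₁ ℓ₂ : Level
  A : Set a
  B : Set b
  m n k : ℕ

-- Counting

injective-length-≤ : {R : REL A B ℓ} {xs : List A} {ys : List B} → Unique xs →
  (∀ {x} → x ∈ xs → ∃[ y ] (y ∈ ys × R x y)) →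
  (∀ {x x′ y} → x ∈ xs → x′ ∈ xs → R x y → R x′ y → x ≡ x′) →
  length xs ≤ length ys
injective-length-≤ [] total inj = z≤n
injective-length-≤ {R = R} {xs = x ∷ xs} (x∉xs ∷ uniq) total inj
  with y , y∈ys , Rxy ← total (here refl)
  with as , bs , refl ← ∈-∃++ y∈ys =
  subst (suc (length xs) ≤_) (sym len)
    (s≤s (injective-length-≤ {R = R} {ys = as ++ bs} uniq total′
      (λ p q → inj (there p) (there q))))
  where
  len : length (as ++ [ y ] ++ bs) ≡ suc (length (as ++ bs))
  len = begin
    length (as ++ [ y ] ++ bs)        ≡⟨ length-++ as ⟩
    length as + suc (length bs)       ≡⟨ ℕ.+-suc (length as) (length bs) ⟩
    suc (length as + length bs)       ≡⟨ cong suc (length-++ as) ⟨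
    suc (length (as ++ bs))           ∎
    where open ≡-Reasoning

  total′ : ∀ {x′} → x′ ∈ xs → ∃[ y′ ] (y′ ∈ as ++ bs × R x′ y′)
  total′ {x′} x′∈xs with total (there x′∈xs)
  ... | y′ , y′∈ys , Rx′y′ with ∈-++⁻ as y′∈ys
  ...   | inj₁ y′∈as         = y′ , ∈-++⁺ˡ y′∈as , Rx′y′
  ...   | inj₂ (there y′∈bs) = y′ , ∈-++⁺ʳ as y′∈bs , Rx′y′
  ...   | inj₂ (here refl)   =
    contradiction (inj (here refl) (there x′∈xs) Rxy Rx′y′) (All.lookup x∉xs x′∈xs)

length-mono-⊆ : {xs ys : List A} → Unique xs → (_∈ xs) ⊆ (_∈ ys) → length xs ≤ length ys
length-mono-⊆ uniq sub =
  injective-length-≤ {R = _≡_} uniq (λ x∈xs → _ , sub x∈xs , refl) (λ { _ _ refl refl → refl })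

HasSize-map : {P : Pred A ℓ₁} {Q : Pred B ℓ₂} {s : ℕ} (f : A → B) →
  (∀ {x y} → f x ≡ f y → x ≡ y) → (∀ {x} → P x → Q (f x)) →
  (∀ {y} → Q y → ∃[ x ] (P x × y ≡ f x)) → HasSize P s → HasSize Q s
HasSize-map {Q = Q} f f-inj P⇒Q Q⇒P (xs , uniq , (P⇒∈ , ∈⇒P) , len) =
  map f xs , Unique.map⁺ f-inj uniq ,
  ( (λ Qy → let x , Px , y≡fx = Q⇒P Qy in subst (_∈ map f xs) (sym y≡fx) (∈-map⁺ f (P⇒∈ Px)))
  , (λ y∈ → let x , x∈xs , y≡fx = ∈-map⁻ f y∈ in subst Q (sym y≡fx) (P⇒Q (∈⇒P x∈xs))) ) ,
  trans (length-map f xs) len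

HasSize-∖ : {P : Pred A ℓ₁} {Q : Pred A ℓ₂} {s t : ℕ} → DecidableEquality A → Q ⊆ P →
  HasSize P s → HasSize Q t → ∃[ r ] (HasSize (P ∖ Q) r × r + t ≡ s)
HasSize-∖ {A = A} _≟_ Q⊆P (xs , uniqx , (P⇒ , ⇒P) , refl) (ys , uniqy , (Q⇒ , ⇒Q) , refl) =
  length zs ,
  (zs , uniqz ,
    ( (λ (Px , ¬Qx) → ∈-filter⁺ ∉ys? (P⇒ Px) (¬Qx ∘ ⇒Q))
    , (λ z∈ → let x∈xs , x∉ys = ∈-filter⁻ ∉ys? z∈ in ⇒P x∈xs , x∉ys ∘ Q⇒) )
    , refl) ,
  trans (sym (length-++ zs)) (ℕ.≤-antisym
    (length-mono-⊆ (Unique.++⁺ uniqz uniqy (λ (z∈ , y∈) → proj₂ (∈-filter⁻ ∉ys? {xs = xs} z∈) y∈))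
      ([ proj₁ ∘ ∈-filter⁻ ∉ys? , P⇒ ∘ Q⊆P ∘ ⇒Q ]′ ∘ ∈-++⁻ zs))
    (length-mono-⊆ uniqx split))
  where
  open DecMembership _≟_ using (_∈?_)
  ∉ys? = λ x → ¬? (x ∈? ys)
  zs = filter ∉ys? xs
  uniqz = Unique.filter⁺ ∉ys? uniqx

  split : (_∈ xs) ⊆ (_∈ zs ++ ys)
  split {x} x∈xs with x ∈? ys
  ... | yes x∈ys = ∈-++⁺ʳ zs x∈ys
  ... | no x∉ys  = ∈-++⁺ˡ (∈-filter⁺ ∉ys? x∈xs x∉ys)

module _ {A : Set a} (G : SimpleGraph A ℓ) where
  open SimpleGraph G

  -- A matching of V₁ into V₂ embeds every independent set into V₂: its elements
  -- in V₁ are replaced by their partners, which it cannot contain.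
  matching-bounds : {V₁ V₂ : Pred A ℓ} {M : REL A A ℓ₁} {s : ℕ} → Vertex ⊆ V₁ ∪ V₂ →
    (∀ {x} → V₁ x → ∃[ y ] (V₂ y × M x y)) → (∀ {x y} → M x y → Adj x y) →
    (∀ {x x′ y} → M x y → M x′ y → x ≡ x′) → HasSize V₂ s → BoundsIndependentSets G s
  matching-bounds {V₁ = V₁} {V₂} {M} cover total adj inj (ys , _ , (V₂⇒ , _) , refl) Q s′ (Q⊆V , indep)
    (xs , uniq , (_ , ⇒Q) , refl) = injective-length-≤ {R = λ x y → M x y ⊎ x ≡ y} uniq total′ inj′
    where
    total′ : ∀ {x} → x ∈ xs → ∃[ y ] (y ∈ ys × (M x y ⊎ x ≡ y))
    total′ x∈xs with cover (Q⊆V (⇒Q x∈xs))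
    ... | inj₁ v = let y , w , Mxy = total v in y , V₂⇒ w , inj₁ Mxy
    ... | inj₂ w = _ , V₂⇒ w , inj₂ refl

    inj′ : ∀ {x x′ y} → x ∈ xs → x′ ∈ xs → M x y ⊎ x ≡ y → M x′ y ⊎ x′ ≡ y → x ≡ x′
    inj′ _ _  (inj₁ p)    (inj₁ q)    = inj p q
    inj′ p q  (inj₁ Mxy)  (inj₂ refl) = contradiction (adj Mxy) (indep (⇒Q p) (⇒Q q))
    inj′ p q  (inj₂ refl) (inj₁ Mxy)  = contradiction (adj Mxy) (indep (⇒Q q) (⇒Q p))
    inj′ _ _  (inj₂ refl) (inj₂ refl) = refl

subsetsOfSize : ∀ n → ℕ → List (Subset n)
subsetsOfSize zero    zero    = [ [] ]
subsetsOfSize zero    (suc k) = []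
subsetsOfSize (suc n) zero    = map (outside ∷_) (subsetsOfSize n zero)
subsetsOfSize (suc n) (suc k) =
  map (inside ∷_) (subsetsOfSize n k) ++ map (outside ∷_) (subsetsOfSize n (suc k))

HasSize-subsetsOfSize : ∀ n k → HasSize (λ (P : Subset n) → ∣ P ∣ ≡ k) (n C k)
HasSize-subsetsOfSize n k = subsetsOfSize n k , unique n k , (complete , sound n k) , len n k
  where
  unique : ∀ n k → Unique (subsetsOfSize n k)
  unique zero    zero    = All.[] ∷ []
  unique zero    (suc k) = []
  unique (suc n) zero    = Unique.map⁺ Vec.∷-injectiveʳ (unique n zero)
  unique (suc n) (suc k) = Unique.++⁺ (Unique.map⁺ Vec.∷-injectiveʳ (unique n k))
    (Unique.map⁺ Vec.∷-injectiveʳ (unique n (suc k))) disj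
    where
    disj : Disjoint (map (inside ∷_) (subsetsOfSize n k)) (map (outside ∷_) (subsetsOfSize n (suc k)))
    disj (p , q) with ∈-map⁻ _ p | ∈-map⁻ _ q
    ... | _ , _ , refl | _ , _ , ()

  complete : ∀ {n k} {P : Subset n} → ∣ P ∣ ≡ k → P ∈ subsetsOfSize n k
  complete {k = zero}  {[]}          refl = here refl
  complete {k = zero}  {outside ∷ P} eq   = ∈-map⁺ (outside ∷_) (complete eq)
  complete {suc n} {suc k} {outside ∷ P} eq =
    ∈-++⁺ʳ (map (inside ∷_) (subsetsOfSize n k)) (∈-map⁺ (outside ∷_) (complete eq))
  complete {k = suc k} {inside ∷ P}  eq   = ∈-++⁺ˡ (∈-map⁺ (inside ∷_) (complete (ℕ.suc-injective eq)))

  sound : ∀ n k {P : Subset n} → P ∈ subsetsOfSize n k → ∣ P ∣ ≡ k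
  sound zero    zero    (here refl) = refl
  sound (suc n) zero    p with _ , q , refl ← ∈-map⁻ _ p = sound n zero q
  sound (suc n) (suc k) p with ∈-++⁻ (map (inside ∷_) (subsetsOfSize n k)) p
  ... | inj₁ q with _ , r , refl ← ∈-map⁻ _ q = cong suc (sound n k r)
  ... | inj₂ q with _ , r , refl ← ∈-map⁻ _ q = sound n (suc k) r

  len : ∀ n k → length (subsetsOfSize n k) ≡ n C k
  len zero    zero    = refl
  len zero    (suc k) = sym (k>n⇒nCk≡0 {0} {suc k} (s≤s z≤n))
  len (suc n) zero    = trans (length-map _ (subsetsOfSize n zero)) (len n zero)
  len (suc n) (suc k) = begin
    length (subsetsOfSize (suc n) (suc k))
      ≡⟨ length-++ (map (inside ∷_) (subsetsOfSize n k)) ⟩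
    length (map (inside ∷_) (subsetsOfSize n k)) + length (map (outside ∷_) (subsetsOfSize n (suc k)))
      ≡⟨ cong₂ _+_ (trans (length-map _ (subsetsOfSize n k)) (len n k))
                   (trans (length-map _ (subsetsOfSize n (suc k))) (len n (suc k))) ⟩
    n C k + n C suc k
      ≡⟨ nCk+nC[k+1]≡[n+1]C[k+1] n k ⟩
    suc n C suc k ∎
    where open ≡-Reasoning

∑₁-suc : ∀ n (f : ℕ → ℕ) → ∑₁ (suc n) f ≡ ∑₁ n f + f (suc n)
∑₁-suc n f = begin
  sum (map f (applyUpTo suc (suc n)))        ≡⟨ cong (sum ∘ map f) (applyUpTo-∷ʳ suc n) ⟨
  sum (map f (applyUpTo suc n ++ [ suc n ])) ≡⟨ cong sum (map-++ f (applyUpTo suc n) [ suc n ]) ⟩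
  sum (map f (applyUpTo suc n) ++ [ f (suc n) ]) ≡⟨ sum-++ (map f (applyUpTo suc n)) [ f (suc n) ] ⟩
  ∑₁ n f + (f (suc n) + 0)                   ≡⟨ cong (_+_ (∑₁ n f)) (ℕ.+-identityʳ (f (suc n))) ⟩
  ∑₁ n f + f (suc n)                         ∎
  where open ≡-Reasoning

binomialTerm : ℕ → ℕ → ℕ
binomialTerm n i = 2 ^ (i ∸ 1) * (n C i)

∑-binomialTerm-pascal : ∀ n m → ∑₁ (suc m) (binomialTerm (suc n))
  ≡ ∑₁ (suc m) (binomialTerm n) + 1 + 2 * ∑₁ m (binomialTerm n)
∑-binomialTerm-pascal n zero = trans (cong (λ c → 1 * c + 0) (sym (nCk+nC[k+1]≡[n+1]C[k+1] n 0)))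
  (lemma (n C 1))
  where
  lemma : ∀ c → 1 * (1 + c) + 0 ≡ 1 * c + 0 + 1 + 2 * 0
  lemma = solve-∀
∑-binomialTerm-pascal n (suc m) = begin
  ∑₁ (2 + m) (binomialTerm (suc n))
    ≡⟨ ∑₁-suc (suc m) (binomialTerm (suc n)) ⟩
  ∑₁ (suc m) (binomialTerm (suc n)) + 2 ^ suc m * (suc n C (2 + m))
    ≡⟨ cong₂ (λ s c → s + 2 ^ suc m * c) (∑-binomialTerm-pascal n m) (sym (nCk+nC[k+1]≡[n+1]C[k+1] n (suc m))) ⟩
  s′ + 1 + 2 * s + 2 * 2 ^ m * (n C suc m + n C (2 + m))
    ≡⟨ lemma s s′ (2 ^ m) (n C suc m) (n C (2 + m)) ⟩
  s′ + 2 * 2 ^ m * (n C (2 + m)) + 1 + 2 * (s + 2 ^ m * (n C suc m))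
    ≡⟨ cong₂ (λ p q → p + 1 + 2 * q) (∑₁-suc (suc m) (binomialTerm n)) (∑₁-suc m (binomialTerm n)) ⟨
  ∑₁ (2 + m) (binomialTerm n) + 1 + 2 * ∑₁ (suc m) (binomialTerm n) ∎
  where
  open ≡-Reasoning
  s = ∑₁ m (binomialTerm n)
  s′ = ∑₁ (suc m) (binomialTerm n)
  lemma : ∀ s s′ p c d → s′ + 1 + 2 * s + 2 * p * (c + d) ≡ s′ + 2 * p * d + 1 + 2 * (s + p * c)
  lemma = solve-∀

∑-binomialTerm-suc : ∀ n → ∑₁ (suc n) (binomialTerm (suc n)) ≡ 1 + 3 * ∑₁ n (binomialTerm n)
∑-binomialTerm-suc n = begin
  ∑₁ (suc n) (binomialTerm (suc n))                      ≡⟨ ∑-binomialTerm-pascal n n ⟩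
  ∑₁ (suc n) (binomialTerm n) + 1 + 2 * s                ≡⟨ cong (λ z → z + 1 + 2 * s) (∑₁-suc n (binomialTerm n)) ⟩
  s + 2 ^ n * (n C suc n) + 1 + 2 * s                    ≡⟨ cong (λ c → s + 2 ^ n * c + 1 + 2 * s) (k>n⇒nCk≡0 (ℕ.n<1+n n)) ⟩
  s + 2 ^ n * 0 + 1 + 2 * s                              ≡⟨ lemma s (2 ^ n) ⟩
  1 + 3 * s                                              ∎
  where
  open ≡-Reasoning
  s = ∑₁ n (binomialTerm n)
  lemma : ∀ s p → s + p * 0 + 1 + 2 * s ≡ 1 + 3 * s
  lemma = solve-∀

-- Signed sets

SignedSet : ℕ → Set
SignedSet m = Subset (suc m) × Subset m

-- (P , N) stands for { xᵢ : i ∈ P } ∪ { - xⱼ : j ∈ N }. The last index has no negative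
-- counterpart in 𝓑ₙ, so a negative index is compared with a positive one through inject₁.
Admissible : SignedSet m → Set
Admissible {m} (P , N) =
    (∀ {j} → j ∈ˢ N → inject₁ j ∉ˢ P)
  × (∃[ i ] (i ∈ˢ P × (∀ {i′} → i′ ∈ˢ P → i′ Fin.≤ i) × (∀ {j} → j ∈ˢ N → inject₁ j Fin.≤ i)))

extend : (s t : Subset.Side) → SignedSet m → SignedSet (suc m)
extend s t (P , N) = s ∷ P , t ∷ N

extend-injective : ∀ {s t s′ t′} {X Y : SignedSet m} → extend s t X ≡ extend s′ t′ Y → X ≡ Y
extend-injective refl = refl

smallest : ∀ m → SignedSet m
smallest m = inside ∷ Subset.⊥ , Subset.⊥

admissibleSets : ∀ m → List (SignedSet m)
admissibleSets zero    = [ smallest zero ]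
admissibleSets (suc m) = smallest (suc m)
  ∷ map (extend outside outside) (admissibleSets m)
  ++ map (extend inside outside) (admissibleSets m)
  ++ map (extend outside inside) (admissibleSets m)

smallest-admissible : ∀ m → Admissible (smallest m)
smallest-admissible m =
    (λ j∈⊥ → ⊥-elim (Subset.∉⊥ j∈⊥))
  , zero , Vec.here , (λ { Vec.here → z≤n ; (Vec.there p) → ⊥-elim (Subset.∉⊥ p) })
  , (λ j∈⊥ → ⊥-elim (Subset.∉⊥ j∈⊥))

extend-admissible : ∀ {s t} {X : SignedSet m} → ¬ (s ≡ inside × t ≡ inside) →
  Admissible X → Admissible (extend s t X)
extend-admissible ¬both (disj , i , i∈P , i-maxP , i-maxN) =
    (λ { Vec.here Vec.here → ¬both (refl , refl) ; (Vec.there p) (Vec.there q) → disj p q })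
  , suc i , Vec.there i∈P
  , (λ { Vec.here → z≤n ; (Vec.there p) → s≤s (i-maxP p) })
  , (λ { Vec.here → z≤n ; (Vec.there p) → s≤s (i-maxN p) })

admissibleSets-sound : ∀ m {X} → X ∈ admissibleSets m → Admissible X
admissibleSets-sound zero    (here refl) = smallest-admissible zero
admissibleSets-sound (suc m) (here refl) = smallest-admissible (suc m)
admissibleSets-sound (suc m) (there p) with ∈-++⁻ (map (extend outside outside) (admissibleSets m)) p
... | inj₁ q with _ , r , refl ← ∈-map⁻ _ q = extend-admissible (λ ()) (admissibleSets-sound m r)
... | inj₂ q with ∈-++⁻ (map (extend inside outside) (admissibleSets m)) q
...   | inj₁ r with _ , r , refl ← ∈-map⁻ _ r = extend-admissible (λ ()) (admissibleSets-sound m r)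
...   | inj₂ r with _ , r , refl ← ∈-map⁻ _ r = extend-admissible (λ ()) (admissibleSets-sound m r)

admissibleSets-complete : (X : SignedSet m) → Admissible X → X ∈ admissibleSets m
admissibleSets-complete {zero} (inside ∷ [] , []) _ = here refl
admissibleSets-complete {zero} (outside ∷ [] , []) (_ , zero , () , _)
admissibleSets-complete {suc m} (inside ∷ P , t ∷ N) (disj , zero , Vec.here , maxP , maxN) =
  here (cong₂ _,_ (cong (inside ∷_) (Subset.Empty-unique λ (i , i∈P) → contradiction (maxP (Vec.there i∈P)) λ ()))
    (Subset.Empty-unique empty))
  where
  empty : Subset.Empty (t ∷ N)
  empty (zero  , j∈N) = disj j∈N Vec.here
  empty (suc j , j∈N) = contradiction (maxN j∈N) λ ()
admissibleSets-complete {suc m} (s ∷ P , t ∷ N) (disj , suc i , Vec.there i∈P , maxP , maxN) =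
  there (place s t (λ { refl refl → disj Vec.here Vec.here }))
  where
  ih : (P , N) ∈ admissibleSets m
  ih = admissibleSets-complete (P , N)
    ( (λ p q → disj (Vec.there p) (Vec.there q)) , i , i∈P
    , (λ p → s≤s⁻¹ (maxP (Vec.there p))) , (λ p → s≤s⁻¹ (maxN (Vec.there p))) )
  Xs = admissibleSets m
  place : ∀ s t → (s ≡ inside → ¬ (t ≡ inside)) → (s ∷ P , t ∷ N) ∈ _
  place outside outside _ = ∈-++⁺ˡ (∈-map⁺ _ ih)
  place inside  outside _ = ∈-++⁺ʳ (map (extend outside outside) Xs) (∈-++⁺ˡ (∈-map⁺ _ ih))
  place outside inside  _ = ∈-++⁺ʳ (map (extend outside outside) Xs) (∈-++⁺ʳ (map (extend inside outside) Xs) (∈-map⁺ _ ih))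
  place inside  inside  h = contradiction refl (h refl)

admissibleSets-unique : ∀ m → Unique (admissibleSets m)
admissibleSets-unique zero    = All.[] ∷ []
admissibleSets-unique (suc m) =
  All.tabulate smallest∉ ∷
  Unique.++⁺ (Unique.map⁺ extend-injective ih)
    (Unique.++⁺ (Unique.map⁺ extend-injective ih) (Unique.map⁺ extend-injective ih) disj₂) disj₁
  where
  ih = admissibleSets-unique m
  Xs = admissibleSets m

  disj₂ : Disjoint (map (extend inside outside) Xs) (map (extend outside inside) Xs)
  disj₂ (p , q) with ∈-map⁻ _ p | ∈-map⁻ _ q
  ... | _ , _ , refl | _ , _ , ()

  disj₁ : Disjoint (map (extend outside outside) Xs)
    (map (extend inside outside) Xs ++ map (extend outside inside) Xs)
  disj₁ (p , q) with ∈-map⁻ _ p | ∈-++⁻ (map (extend inside outside) Xs) q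
  ... | _ , _ , refl | inj₁ q with () ← proj₂ (proj₂ (∈-map⁻ _ q))
  ... | _ , _ , refl | inj₂ q with () ← proj₂ (proj₂ (∈-map⁻ _ q))

  smallest∉ : ∀ {X} → X ∈ map (extend outside outside) Xs ++ map (extend inside outside) Xs
    ++ map (extend outside inside) Xs → ¬ (smallest (suc m) ≡ X)
  smallest∉ p refl with ∈-++⁻ (map (extend outside outside) Xs) p
  ... | inj₁ q with () ← proj₂ (proj₂ (∈-map⁻ _ q))
  ... | inj₂ q with ∈-++⁻ (map (extend inside outside) Xs) q
  ...   | inj₁ r with _ , ∈Xs , refl ← ∈-map⁻ _ r
                 with _ , _ , i∈⊥ , _ ← admissibleSets-sound m ∈Xs = Subset.∉⊥ i∈⊥
  ...   | inj₂ r with () ← proj₂ (proj₂ (∈-map⁻ _ r))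

length-admissibleSets : ∀ m → length (admissibleSets m) ≡ ∑₁ (suc m) (binomialTerm (suc m))
length-admissibleSets zero    = refl
length-admissibleSets (suc m) = begin
  suc (length (map (extend outside outside) Xs ++ map (extend inside outside) Xs ++ map (extend outside inside) Xs))
    ≡⟨ cong suc (trans (length-++ (map (extend outside outside) Xs))
         (cong (_+_ (length (map (extend outside outside) Xs))) (length-++ (map (extend inside outside) Xs)))) ⟩
  suc (length (map (extend outside outside) Xs) + (length (map (extend inside outside) Xs) + length (map (extend outside inside) Xs)))
    ≡⟨ cong suc (cong₂ _+_ (length-map _ Xs) (cong₂ _+_ (length-map _ Xs) (trans (length-map _ Xs) (sym (ℕ.+-identityʳ _))))) ⟩
  1 + 3 * length Xs
    ≡⟨ cong (λ l → 1 + 3 * l) (length-admissibleSets m) ⟩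
  1 + 3 * ∑₁ (suc m) (binomialTerm (suc m))
    ≡⟨ ∑-binomialTerm-suc (suc m) ⟨
  ∑₁ (2 + m) (binomialTerm (2 + m)) ∎
  where
  open ≡-Reasoning
  Xs = admissibleSets m

HasSize-Admissible : ∀ m → HasSize (Admissible {m}) (∑₁ (suc m) (binomialTerm (suc m)))
HasSize-Admissible m = admissibleSets m , admissibleSets-unique m ,
  ((λ {X} → admissibleSets-complete X) , admissibleSets-sound m) , length-admissibleSets m

∈-init⁺ : ∀ {P : Subset (suc m)} {j} → inject₁ j ∈ˢ P → j ∈ˢ init P
∈-init⁺ {P = _ ∷ _} {zero}  Vec.here      = Vec.here
∈-init⁺ {P = _ ∷ _} {suc j} (Vec.there p) = Vec.there (∈-init⁺ p)

∈-init⁻ : ∀ {P : Subset (suc m)} {j} → j ∈ˢ init P → inject₁ j ∈ˢ P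
∈-init⁻ {P = _ ∷ _ ∷ _} Vec.here      = Vec.here
∈-init⁻ {P = _ ∷ _ ∷ _} (Vec.there p) = Vec.there (∈-init⁻ p)

init-∣∣-injective : (P Q : Subset (suc m)) → init P ≡ init Q → ∣ P ∣ ≡ ∣ Q ∣ → P ≡ Q
init-∣∣-injective (inside  ∷ [])    (inside  ∷ [])    _  _  = refl
init-∣∣-injective (outside ∷ [])    (outside ∷ [])    _  _  = refl
init-∣∣-injective (s ∷ P@(_ ∷ _)) (t ∷ Q@(_ ∷ _)) eq c with refl ← Vec.∷-injectiveˡ eq =
  cong (s ∷_) (init-∣∣-injective P Q (Vec.∷-injectiveʳ eq) (cancel s c))
  where
  cancel : ∀ s → ∣ s ∷ P ∣ ≡ ∣ s ∷ Q ∣ → ∣ P ∣ ≡ ∣ Q ∣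
  cancel inside  = ℕ.suc-injective
  cancel outside = id

init≡⊥⇒∣∣≤1 : (P : Subset (suc m)) → init P ≡ Subset.⊥ → ∣ P ∣ ≤ 1
init≡⊥⇒∣∣≤1 (inside  ∷ []) _ = ℕ.≤-refl
init≡⊥⇒∣∣≤1 (outside ∷ []) _ = z≤n
init≡⊥⇒∣∣≤1 (outside ∷ P@(_ ∷ _)) eq = init≡⊥⇒∣∣≤1 P (Vec.∷-injectiveʳ eq)

-- Adding x₁ when it is absent keeps {xₙ} from being its own partner when k = 1.
partner : Subset (2 + m) → SignedSet (suc m)
partner {m} P@(s ∷ _) = not s ∷ ⁅ fromℕ m ⁆ , init P

1≤∣P∣⇒Nonempty : (P : Subset n) → 1 ≤ ∣ P ∣ → Subset.Nonempty P
1≤∣P∣⇒Nonempty (inside  ∷ P) _  = zero , Vec.here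
1≤∣P∣⇒Nonempty (outside ∷ P) 1≤ = let i , i∈P = 1≤∣P∣⇒Nonempty P 1≤ in suc i , Vec.there i∈P

maximum : (P : Subset n) → Subset.Nonempty P → ∃[ i ] (i ∈ˢ P × (∀ {i′} → i′ ∈ˢ P → i′ Fin.≤ i))
maximum (s ∷ P) nonempty with Subset.nonempty? P
maximum (s ∷ P) nonempty | yes nonemptyP = let i , i∈P , max = maximum P nonemptyP in
  suc i , Vec.there i∈P , λ { Vec.here → z≤n ; (Vec.there p) → s≤s (max p) }
maximum (s ∷ P) (zero  , Vec.here)    | no emptyP =
  zero , Vec.here , λ { Vec.here → z≤n ; (Vec.there p) → contradiction (_ , p) emptyP }
maximum (s ∷ P) (suc i , Vec.there p) | no emptyP = contradiction (i , p) emptyP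

partner-admissible : (P : Subset (2 + m)) → Admissible (partner P)
partner-admissible {m} P@(s ∷ _ ∷ _) =
    disj , suc (fromℕ m) , Vec.there (Subset.x∈⁅x⁆ (fromℕ m)) , (λ _ → Fin.≤fromℕ _) , (λ _ → Fin.≤fromℕ _)
  where
  not-inside : ∀ {s} → s ≡ inside → ¬ (not s ≡ inside)
  not-inside refl ()

  disj : ∀ {j} → j ∈ˢ init P → inject₁ j ∉ˢ (not s ∷ ⁅ fromℕ m ⁆)
  disj {zero}  p q = not-inside (Vec.[]=⇒lookup p) (Vec.[]=⇒lookup q)
  disj {suc j} _ (Vec.there q) = Fin.fromℕ≢inject₁ (sym (Subset.x∈⁅y⁆⇒x≡y _ q))

∣partner∣ : (P : Subset (2 + m)) → proj₂ (partner P) ≡ Subset.⊥ → ∣ P ∣ < ∣ proj₁ (partner P) ∣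
∣partner∣ {m} (outside ∷ P@(_ ∷ _)) eq =
  subst (∣ P ∣ <_) (cong suc (sym (Subset.∣⁅x⁆∣≡1 (fromℕ m)))) (s≤s (init≡⊥⇒∣∣≤1 P (Vec.∷-injectiveʳ eq)))

partner-covers : (P : Subset (2 + m)) → ∀ {i} → i ∈ˢ P →
  i ∈ˢ proj₁ (partner P) ⊎ ∃[ j ] (j ∈ˢ proj₂ (partner P) × i ≡ inject₁ j)
partner-covers {m} P@(_ ∷ _) {i} i∈P with view i
... | ‵fromℕ     = inj₁ (Vec.there (Subset.x∈⁅x⁆ (fromℕ m)))
... | ‵inject₁ j = inj₂ (j , ∈-init⁺ i∈P , refl)

-- Reals

-- _≈ℝ_, _<ℝ_ and _≤ℝ_ unfold to statements about cuts, from which Agda cannot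
-- recover the reals compared; hence the explicit implicit arguments below.

module _ {x y : ℝ} where

  ≈ℝ-sym : x ≈ℝ y → y ≈ℝ x
  ≈ℝ-sym (p , q) = q , p

  ≈ℝ-trans : ∀ {z} → x ≈ℝ y → y ≈ℝ z → x ≈ℝ z
  ≈ℝ-trans (p , q) (r , s) = r ∘ p , q ∘ s

  ≈ℝ-U : x ≈ℝ y → ℝ.U x ⊆ ℝ.U y
  ≈ℝ-U (_ , q) Ux with p , p<r , Uxp ← ℝ.U-open x Ux with ℝ.located y p<r
  ... | inj₁ Lyp = ⊥-elim (ℝ.disjoint x (q Lyp) Uxp)
  ... | inj₂ Uyr = Uyr

  <ℝ⇒≱ℝ : x <ℝ y → ¬ (y ≤ℝ x)
  <ℝ⇒≱ℝ (q , Uxq , Lyq) y≤x = ℝ.disjoint x (y≤x Lyq) Uxq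

≈-unique : (f : B → ℝ) → ∀ {i j a b} → i ≡ j → a ≈ℝ f i → b ≈ℝ f j → a ≈ℝ b
≈-unique f {i} {a = a} {b} refl p q = ≈ℝ-trans {a} {f i} {b} p (≈ℝ-sym {b} {f i} q)

<ℝ-respʳ : ∀ {x y z} → y ≈ℝ z → x <ℝ y → x <ℝ z
<ℝ-respʳ (p , _) (q , Uxq , Lyq) = q , Uxq , p Lyq

-ℝ-cong : ∀ {x y} → x ≈ℝ y → -ℝ x ≈ℝ -ℝ y
-ℝ-cong {x} {y} eq = ≈ℝ-U {x} {y} eq , ≈ℝ-U {y} {x} (≈ℝ-sym {x} {y} eq)

∣∣ℝ-cong : ∀ {x y} → x ≈ℝ y → ∣ x ∣ℝ ≈ℝ ∣ y ∣ℝ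
∣∣ℝ-cong {x} {y} eq@(p , q) = [ inj₁ ∘ p , inj₂ ∘ proj₁ -eq ]′ , [ inj₁ ∘ q , inj₂ ∘ proj₂ -eq ]′
  where -eq = -ℝ-cong {x} {y} eq

module _ (x : ℝ) (0<x : 0ℝ <ℝ x) where
  private
    neg-neg : ∀ q → ℚ.- (ℚ.- q) ≡ q
    neg-neg = GroupProperties.⁻¹-involutive ℚ.+-0-group

    -- A rational below - x is negative, hence below the positive x.
    L- : ∀ {q} → ℝ.L (-ℝ x) q → ℝ.L x q
    L- {q} Ux-q with ℚ.<-cmp q ℚ.0ℚ
    ... | tri< q<0 _ _ = let r , 0<r , Lxr = 0<x in ℝ.L-lower x (ℚ.<-trans q<0 0<r) Lxr
    ... | tri≈ _ refl _ = let r , 0<r , Lxr = 0<x in ⊥-elim (ℝ.disjoint x (ℝ.L-lower x 0<r Lxr) Ux-q)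
    ... | tri> _ _ 0<q = let r , 0<r , Lxr = 0<x in
      ⊥-elim (ℝ.disjoint x (ℝ.L-lower x (ℚ.<-trans (ℚ.neg-antimono-< 0<q) 0<r) Lxr) Ux-q)

  ∣x∣≈x : ∣ x ∣ℝ ≈ℝ x
  ∣x∣≈x = [ id , L- ]′ , inj₁

  ∣-x∣≈x : ∣ -ℝ x ∣ℝ ≈ℝ x
  ∣-x∣≈x = [ L- , subst (ℝ.L x) (neg-neg _) ]′ , (λ l → inj₂ (subst (ℝ.L x) (sym (neg-neg _)) l))

  -x≯0 : ¬ (0ℝ <ℝ -ℝ x)
  -x≯0 (q , 0<q , Ux-q) = let r , 0<r , Lxr = 0<x in
    ℝ.disjoint x (ℝ.L-lower x (ℚ.<-trans (ℚ.neg-antimono-< 0<q) 0<r) Lxr) Ux-q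

∣P++⊥∣ : (P : Subset n) → ∣ P ++ᵛ Subset.⊥ {m} ∣ ≡ ∣ P ∣
∣P++⊥∣ {m = m} []    = Subset.∣⊥∣≡0 m
∣P++⊥∣ (inside  ∷ P) = cong suc (∣P++⊥∣ P)
∣P++⊥∣ (outside ∷ P) = ∣P++⊥∣ P

toSubset : SignedSet m → Subset (suc m + m)
toSubset (P , N) = P ++ᵛ N

toSubset-injective : {X Y : SignedSet m} → toSubset X ≡ toSubset Y → X ≡ Y
toSubset-injective {X = P , N} {P′ , N′} eq = uncurry (cong₂ _,_) (Vec.++-injective P P′ eq)

splitView : ∀ n {m} (i : Fin (n + m)) → ∃[ j ] (i ≡ j ↑ˡ m) ⊎ ∃[ j ] (i ≡ n ↑ʳ j)
splitView n i with splitAt n i in eq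
... | inj₁ j = inj₁ (j , sym (Fin.splitAt⁻¹-↑ˡ eq))
... | inj₂ j = inj₂ (j , sym (Fin.splitAt⁻¹-↑ʳ {n} eq))

toSubset-surjective : (S : Subset (suc m + m)) → ∃[ X ] (S ≡ toSubset {m} X)
toSubset-surjective {m} S with P , N , eq ← Vec.splitAt (suc m) S = (P , N) , eq

module IndexedReals {m : ℕ} (k : ℕ) (x : Fin (suc m) → ℝ) (0<x : ∀ i → 0ℝ <ℝ x i)
  (x-mono : ∀ {i j} → i Fin.< j → x i <ℝ x j) where
  open KneserB (suc m) k x

  -x : Fin m → ℝ
  -x j = -ℝ x (inject₁ j)

  ∣xᵢ∣≈xᵢ : ∀ i → ∣ x i ∣ℝ ≈ℝ x i
  ∣xᵢ∣≈xᵢ i = ∣x∣≈x (x i) (0<x i)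

  ∣-xⱼ∣≈xⱼ : ∀ j → ∣ -x j ∣ℝ ≈ℝ x (inject₁ j)
  ∣-xⱼ∣≈xⱼ j = ∣-x∣≈x (x (inject₁ j)) (0<x (inject₁ j))

  -xⱼ≯0 : ∀ j → ¬ (0ℝ <ℝ -x j)
  -xⱼ≯0 j = -x≯0 (x (inject₁ j)) (0<x (inject₁ j))

  x-cancel-≤ : ∀ {i j} → x i ≤ℝ x j → i Fin.≤ j
  x-cancel-≤ {i} {j} xi≤xj = ℕ.≮⇒≥ λ j<i → <ℝ⇒≱ℝ {x j} {x i} (x-mono j<i) xi≤xj

  x-mono-≤ : ∀ {i j} → i Fin.≤ j → x i ≤ℝ x j
  x-mono-≤ {i} {j} i≤j with ℕ.m≤n⇒m<n∨m≡n i≤j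
  ... | inj₂ eq rewrite Fin.toℕ-injective eq = id
  ... | inj₁ i<j with q , Uq , Lq ← x-mono i<j = below
    where
    below : x i ≤ℝ x j
    below {r} Lr with ℚ.<-cmp r q
    ... | tri< r<q _ _  = ℝ.L-lower (x j) r<q Lq
    ... | tri≈ _ refl _ = Lq
    ... | tri> _ _ q<r  = ⊥-elim (ℝ.disjoint (x i) (ℝ.L-lower (x i) q<r Lr) Uq)

  x≉-x : ∀ {i j} → ¬ (x i ≈ℝ -x j)
  x≉-x {i} {j} eq = -xⱼ≯0 j (<ℝ-respʳ {0ℝ} {x i} { -x j } eq (0<x i))

  𝓑-pos : ∀ i → 𝓑 (i ↑ˡ m) ≡ x i
  𝓑-pos i = Vector.lookup-++ˡ x _ i

  𝓑-neg : ∀ j → 𝓑 (suc m ↑ʳ j) ≡ -x j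
  𝓑-neg j = trans (Vector.lookup-++ʳ x _ j)
    (cong (λ i → -ℝ x i) (Fin.toℕ-injective (trans (Fin.toℕ-inject≤ j _) (sym (Fin.toℕ-inject₁ j)))))

  data _∈⟦_⟧ (r : ℝ) : SignedSet m → Set where
    pos : ∀ {P N i} → i ∈ˢ P → r ≈ℝ x i → r ∈⟦ P , N ⟧
    neg : ∀ {P N j} → j ∈ˢ N → r ≈ℝ -x j → r ∈⟦ P , N ⟧

  ∈⟦⟧⇒ : ∀ {r X} → r ∈⟦ X ⟧ → ⟦ toSubset X ⟧ r
  ∈⟦⟧⇒ {r} {P , N} (pos {i = i} i∈P eq) = i ↑ˡ m ,
    Vec.lookup⇒[]= _ (P ++ᵛ N) (trans (Vec.lookup-++ˡ P N i) (Vec.[]=⇒lookup i∈P)) ,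
    subst (r ≈ℝ_) (sym (𝓑-pos i)) eq
  ∈⟦⟧⇒ {r} {P , N} (neg {j = j} j∈N eq) = suc m ↑ʳ j ,
    Vec.lookup⇒[]= _ (P ++ᵛ N) (trans (Vec.lookup-++ʳ P N j) (Vec.[]=⇒lookup j∈N)) ,
    subst (r ≈ℝ_) (sym (𝓑-neg j)) eq

  ∈⟦⟧⇐ : ∀ {r} X → ⟦ toSubset X ⟧ r → r ∈⟦ X ⟧
  ∈⟦⟧⇐ {r} (P , N) (i , i∈ , eq) with splitView (suc m) i
  ... | inj₁ (i′ , refl) =
    pos (Vec.lookup⇒[]= _ P (trans (sym (Vec.lookup-++ˡ P N i′)) (Vec.[]=⇒lookup i∈)))
      (subst (r ≈ℝ_) (𝓑-pos i′) eq)
  ... | inj₂ (j , refl) =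
    neg (Vec.lookup⇒[]= _ N (trans (sym (Vec.lookup-++ʳ P N j)) (Vec.[]=⇒lookup i∈)))
      (subst (r ≈ℝ_) (𝓑-neg j) eq)

  ∣pos∣ : ∀ {a i} → a ≈ℝ x i → ∣ a ∣ℝ ≈ℝ x i
  ∣pos∣ {a} {i} eq = ≈ℝ-trans {∣ a ∣ℝ} {∣ x i ∣ℝ} {x i} (∣∣ℝ-cong {a} {x i} eq) (∣xᵢ∣≈xᵢ i)

  ∣neg∣ : ∀ {a j} → a ≈ℝ -x j → ∣ a ∣ℝ ≈ℝ x (inject₁ j)
  ∣neg∣ {a} {j} eq = ≈ℝ-trans {∣ a ∣ℝ} {∣ -x j ∣ℝ} {x (inject₁ j)} (∣∣ℝ-cong {a} { -x j } eq) (∣-xⱼ∣≈xⱼ j)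

  cancel-∣∣-≤ : ∀ {a b i j} → ∣ a ∣ℝ ≈ℝ x i → ∣ b ∣ℝ ≈ℝ x j → ∣ a ∣ℝ ≤ℝ ∣ b ∣ℝ → i Fin.≤ j
  cancel-∣∣-≤ (_ , p) (q , _) a≤b = x-cancel-≤ (q ∘ a≤b ∘ p)

  mono-∣∣-≤ : ∀ {a b i j} → ∣ a ∣ℝ ≈ℝ x i → ∣ b ∣ℝ ≈ℝ x j → i Fin.≤ j → ∣ a ∣ℝ ≤ℝ ∣ b ∣ℝ
  mono-∣∣-≤ (p , _) (_ , q) i≤j = q ∘ x-mono-≤ i≤j ∘ p

  ≈-refl : ∀ {r} → r ≈ℝ r
  ≈-refl = id , id

  φ⇒Admissible : ∀ {X} → φ (toSubset X) → Admissible X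
  φ⇒Admissible {P , N} (_ , distinct , (a , a∈ , a-max , 0<a)) = disj , largest (∈⟦⟧⇐ {a} (P , N) a∈)
    where
    ∈P : ∀ {i} → i ∈ˢ P → ⟦ toSubset (P , N) ⟧ (x i)
    ∈P {i} i∈P = ∈⟦⟧⇒ {x i} {P , N} (pos i∈P (≈-refl {x i}))

    ∈N : ∀ {j} → j ∈ˢ N → ⟦ toSubset (P , N) ⟧ (-x j)
    ∈N {j} j∈N = ∈⟦⟧⇒ { -x j } {P , N} (neg j∈N (≈-refl { -x j }))

    disj : ∀ {j} → j ∈ˢ N → inject₁ j ∉ˢ P
    disj {j} j∈N i∈P = x≉-x {inject₁ j} {j} (distinct {x (inject₁ j)} { -x j } (∈P i∈P) (∈N j∈N)
      (≈ℝ-trans {∣ x (inject₁ j) ∣ℝ} {x (inject₁ j)} {∣ -x j ∣ℝ} (∣xᵢ∣≈xᵢ (inject₁ j))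
        (≈ℝ-sym {∣ -x j ∣ℝ} {x (inject₁ j)} (∣-xⱼ∣≈xⱼ j))))

    largest : a ∈⟦ P , N ⟧ →
      ∃[ i ] (i ∈ˢ P × (∀ {i′} → i′ ∈ˢ P → i′ Fin.≤ i) × (∀ {j} → j ∈ˢ N → inject₁ j Fin.≤ i))
    largest (neg {j = j} _ a≈-x) = contradiction (<ℝ-respʳ {0ℝ} {a} { -x j } a≈-x 0<a) (-xⱼ≯0 j)
    largest (pos {i = i} i∈P a≈x) = i , i∈P
      , (λ {i′} p → cancel-∣∣-≤ {x i′} {a} (∣xᵢ∣≈xᵢ i′) (∣pos∣ {a} a≈x) (a-max {x i′} (∈P p)))
      , (λ {j} p → cancel-∣∣-≤ { -x j } {a} (∣-xⱼ∣≈xⱼ j) (∣pos∣ {a} a≈x) (a-max { -x j } (∈N p)))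

  Admissible⇒φ : ∀ {X} → Admissible X → φ (toSubset X)
  Admissible⇒φ {P , N} (disj , i , i∈P , maxP , maxN) =
    (x i , xi∈) , (λ {a} {b} a∈ b∈ → distinct {a} {b} (∈⟦⟧⇐ {a} (P , N) a∈) (∈⟦⟧⇐ {b} (P , N) b∈)) ,
    (x i , xi∈ , (λ {b} b∈ → max {b} (∈⟦⟧⇐ {b} (P , N) b∈)) , 0<x i)
    where
    xi∈ : ⟦ toSubset (P , N) ⟧ (x i)
    xi∈ = ∈⟦⟧⇒ {x i} {P , N} (pos i∈P (≈-refl {x i}))

    max : ∀ {b} → b ∈⟦ P , N ⟧ → ∣ b ∣ℝ ≤ℝ ∣ x i ∣ℝ
    max {b} (pos p eq) = mono-∣∣-≤ {b} {x i} (∣pos∣ {b} eq) (∣xᵢ∣≈xᵢ i) (maxP p)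
    max {b} (neg p eq) = mono-∣∣-≤ {b} {x i} (∣neg∣ {b} eq) (∣xᵢ∣≈xᵢ i) (maxN p)

    same-index : ∀ {a b i j} → ∣ a ∣ℝ ≈ℝ x i → ∣ b ∣ℝ ≈ℝ x j → ∣ a ∣ℝ ≈ℝ ∣ b ∣ℝ → i ≡ j
    same-index {a} {b} p q (r , s) =
      Fin.≤-antisym (cancel-∣∣-≤ {a} {b} p q r) (cancel-∣∣-≤ {b} {a} q p s)

    distinct : ∀ {a b} → a ∈⟦ P , N ⟧ → b ∈⟦ P , N ⟧ → ∣ a ∣ℝ ≈ℝ ∣ b ∣ℝ → a ≈ℝ b
    distinct {a} {b} (pos {i = i} _ p) (pos {i = i′} _ q) eq =
      ≈-unique x {a = a} {b} (same-index {a} {b} (∣pos∣ {a} {i} p) (∣pos∣ {b} {i′} q) eq) p q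
    distinct {a} {b} (neg {j = j} _ p) (neg {j = j′} _ q) eq =
      ≈-unique -x {a = a} {b}
        (Fin.inject₁-injective (same-index {a} {b} (∣neg∣ {a} {j} p) (∣neg∣ {b} {j′} q) eq)) p q
    distinct {a} {b} (pos {i = i} i∈P p) (neg {j = j} j∈N q) eq = contradiction
      (subst (_∈ˢ P) (same-index {a} {b} (∣pos∣ {a} {i} p) (∣neg∣ {b} {j} q) eq) i∈P) (disj j∈N)
    distinct {a} {b} (neg {j = j} j∈N p) (pos {i = i} i∈P q) eq = contradiction
      (subst (_∈ˢ P) (sym (same-index {a} {b} (∣neg∣ {a} {j} p) (∣pos∣ {b} {i} q) eq)) i∈P) (disj j∈N)

  V₁⇒ : ∀ {P N} → V₁ (toSubset (P , N)) → N ≡ Subset.⊥ × ∣ P ∣ ≡ k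
  V₁⇒ {P} {N} (⊆𝓑⁺ , size) = N≡⊥ , trans (sym (∣P++⊥∣ P)) (subst (λ N → ∣ P ++ᵛ N ∣ ≡ k) N≡⊥ size)
    where
    N≡⊥ : N ≡ Subset.⊥
    N≡⊥ = Subset.Empty-unique λ (j , j∈N) →
      let i , eq = ⊆𝓑⁺ { -x j } (∈⟦⟧⇒ { -x j } {P , N} (neg j∈N (≈-refl { -x j })))
      in x≉-x {i} {j} (≈ℝ-sym { -x j } {x i} eq)

  V₁⇐ : ∀ {P} → ∣ P ∣ ≡ k → V₁ (toSubset (P , Subset.⊥))
  V₁⇐ {P} size = (λ {r} r∈ → positive {r} (∈⟦⟧⇐ {r} (P , Subset.⊥) r∈)) , trans (∣P++⊥∣ P) size
    where
    positive : ∀ {r} → r ∈⟦ P , Subset.⊥ ⟧ → 𝓑⁺ r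
    positive (pos {i = i} _ eq) = i , eq
    positive (neg j∈⊥ _)        = ⊥-elim (Subset.∉⊥ j∈⊥)

  HasSize-φ : HasSize φ (∑₁ (suc m) (binomialTerm (suc m)))
  HasSize-φ = HasSize-map toSubset toSubset-injective Admissible⇒φ preimage (HasSize-Admissible m)
    where
    preimage : ∀ {S} → φ S → ∃[ X ] (Admissible X × S ≡ toSubset X)
    preimage {S} φS with X , refl ← toSubset-surjective {m} S = X , φ⇒Admissible {X} φS , refl

  V₁-preimage : ∀ {S} → V₁ S → ∃[ P ] (∣ P ∣ ≡ k × S ≡ toSubset (P , Subset.⊥))
  V₁-preimage {S} V₁S with (P , N) , refl ← toSubset-surjective {m} S
                      with refl , size ← V₁⇒ {P} {N} V₁S = P , size , refl

  HasSize-V₁ : HasSize V₁ (suc m C k)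
  HasSize-V₁ = HasSize-map (λ P → toSubset (P , Subset.⊥)) (cong proj₁ ∘ toSubset-injective)
    V₁⇐ V₁-preimage (HasSize-subsetsOfSize (suc m) k)

  V₁⊆φ : 1 ≤ k → V₁ ⊆ φ
  V₁⊆φ 1≤k {S} V₁S with (P , N) , refl ← toSubset-surjective {m} S
                   with refl , refl ← V₁⇒ {P} {N} V₁S =
    Admissible⇒φ {P , Subset.⊥} ((λ j∈⊥ → ⊥-elim (Subset.∉⊥ j∈⊥)) , largest 1≤k)
    where
    largest : 1 ≤ ∣ P ∣ → ∃[ i ] (i ∈ˢ P × (∀ {i′} → i′ ∈ˢ P → i′ Fin.≤ i)
      × (∀ {j} → j ∈ˢ Subset.⊥ → inject₁ j Fin.≤ i))
    largest 1≤∣P∣ = let i , i∈P , max = maximum P (1≤∣P∣⇒Nonempty P 1≤∣P∣) in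
      i , i∈P , max , (λ j∈⊥ → ⊥-elim (Subset.∉⊥ j∈⊥))

  HasSize-V₂ : 1 ≤ k → ∃[ r ] (HasSize V₂ r × r + suc m C k ≡ ∑₁ (suc m) (binomialTerm (suc m)))
  HasSize-V₂ 1≤k = HasSize-∖ (Vec.≡-dec _≟ᵇ_) (V₁⊆φ 1≤k) HasSize-φ HasSize-V₁

  V₂-independent : IsIndependent H_B V₂
  V₂-independent = inj₂ , λ where
    v₂ _ (inj₁ (v₁ , _)) → proj₂ v₂ v₁
    _ v₂ (inj₂ (v₁ , _)) → proj₂ v₂ v₁

module Matching {m : ℕ} (k : ℕ) (x : Fin (2 + m) → ℝ) (0<x : ∀ i → 0ℝ <ℝ x i)
  (x-mono : ∀ {i j} → i Fin.< j → x i <ℝ x j) where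
  open KneserB (2 + m) k x
  open IndexedReals k x 0<x x-mono

  data Matched : Subset (2 + m + suc m) → Subset (2 + m + suc m) → Set where
    matched : ∀ P → ∣ P ∣ ≡ k → Matched (toSubset (P , Subset.⊥)) (toSubset (partner P))

  Matched-injective : ∀ {X X′ Y} → Matched X Y → Matched X′ Y → X ≡ X′
  Matched-injective = λ M M′ → inj M M′ refl
    where
    inj : ∀ {X X′ Y Y′} → Matched X Y → Matched X′ Y′ → Y ≡ Y′ → X ≡ X′
    inj (matched P@(_ ∷ _) p) (matched P′@(_ ∷ _) p′) eq = cong (λ P → toSubset (P , Subset.⊥))
      (init-∣∣-injective P P′ (cong proj₂ (toSubset-injective {X = partner P} {partner P′} eq)) (trans p (sym p′)))

  partner∈V₂ : ∀ P → ∣ P ∣ ≡ k → V₂ (toSubset (partner P))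
  partner∈V₂ P size = Admissible⇒φ {partner P} (partner-admissible P) , λ v →
    let N≡⊥ , size′ = V₁⇒ {proj₁ (partner P)} {proj₂ (partner P)} v
    in ℕ.<-irrefl (trans size (sym size′)) (∣partner∣ P N≡⊥)

  Matched⇒Joined : ∀ {X Y} → Matched X Y → Joined X Y
  Matched⇒Joined (matched P size) = V₁⇐ size , partner∈V₂ P size ,
    inj₁ (λ {r} r∈ → covered {r} (∈⟦⟧⇐ {r} (P , Subset.⊥) r∈))
    where
    covered : ∀ {r} → r ∈⟦ P , Subset.⊥ ⟧ → (⟦ toSubset (partner P) ⟧ †) r
    covered (neg j∈⊥ _) = ⊥-elim (Subset.∉⊥ j∈⊥)
    covered {r} (pos {i = i} i∈P r≈) = by (partner-covers P i∈P)
      where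
      by : i ∈ˢ proj₁ (partner P) ⊎ ∃[ j ] (j ∈ˢ proj₂ (partner P) × i ≡ inject₁ j) →
        (⟦ toSubset (partner P) ⟧ †) r
      by (inj₁ i∈) = x i
        , ∈⟦⟧⇒ {x i} {partner P} (pos i∈ (id , id))
        , ≈ℝ-trans {r} {x i} {∣ x i ∣ℝ} r≈ (≈ℝ-sym {∣ x i ∣ℝ} {x i} (∣xᵢ∣≈xᵢ i))
      by (inj₂ (j , j∈ , refl)) = -ℝ x i
        , ∈⟦⟧⇒ { -ℝ x i } {partner P} (neg j∈ (id , id))
        , ≈ℝ-trans {r} {x i} {∣ -ℝ x i ∣ℝ} r≈ (≈ℝ-sym {∣ -ℝ x i ∣ℝ} {x i} (∣-xⱼ∣≈xⱼ j))

  V₂-bounds : ∀ {s} → HasSize V₂ s → BoundsIndependentSets H_B s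
  V₂-bounds = matching-bounds H_B {M = Matched} id partnered (inj₁ ∘ Matched⇒Joined) Matched-injective
    where
    partnered : ∀ {X} → V₁ X → ∃[ Y ] (V₂ Y × Matched X Y)
    partnered V₁X = let P , size , X≡ = V₁-preimage V₁X in
      toSubset (partner P) , partner∈V₂ P size ,
      subst (λ X → Matched X (toSubset (partner P))) (sym X≡) (matched P size)

mainTheorem2 : (n k : ℕ) → 2 ≤ n → 1 ≤ k → k < n →
    (x : Fin n → ℝ) →
    (∀ i → 0ℝ <ℝ x i) →
    (∀ {i j} → i Fin.< j → x i <ℝ x j) →
    (∃[ α ] (IsIndependenceNumber (KneserB.H_B n k x) α
    × + α ≡ + ∑₁ n (λ i → 2 ^ (i ∸ 1) * (n C i)) ℤ.- + (n C k)))
    × IsMaximumIndependentSet (KneserB.H_B n k x) (KneserB.V₂ n k x)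
mainTheorem2 (suc (suc m)) k (s≤s (s≤s _)) 1≤k _ x 0<x x-mono =
    (α , ((V₂ , V₂-independent , size) , bounds) , α≡) , V₂-independent , α , size , bounds
  where
  open KneserB (2 + m) k x
  open IndexedReals k x 0<x x-mono
  open Matching k x 0<x x-mono
  V₂-size = HasSize-V₂ 1≤k
  α = proj₁ V₂-size
  size = proj₁ (proj₂ V₂-size)
  bounds = V₂-bounds size

  α≡ : + α ≡ + ∑₁ (2 + m) (binomialTerm (2 + m)) ℤ.- + ((2 + m) C k)
  α≡ = begin
    + α                                          ≡⟨ ℤ.+-identityʳ (+ α) ⟨
    + α ℤ.+ + 0                                  ≡⟨ cong (ℤ._+_ (+ α)) (ℤ.+-inverseʳ (+ c)) ⟨
    + α ℤ.+ (+ c ℤ.- + c)                        ≡⟨ ℤ.+-assoc (+ α) (+ c) (ℤ.- + c) ⟨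
    + (α + c) ℤ.- + c                            ≡⟨ cong (λ s → + s ℤ.- + c) (proj₂ (proj₂ V₂-size)) ⟩
    + ∑₁ (2 + m) (binomialTerm (2 + m)) ℤ.- + c  ∎
    where
    open ≡-Reasoning
    c = (2 + m) C k
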